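{- Let $r\geq 2$. Then there exists $k_0$ such that for all $k\geq k_0$, $\mathrm{bal}_r(n,P_{2rk})=o(n^2)$ as $n\to\infty$.
   Context: $P_m$ denotes the path with $m$ edges. An $r$-edge-colored graph $G$ is balanced if each of the $r$ colors appears on either $\lfloor e(G)/r\rfloor$ or $\lceil e(G)/r\rceil$ edges. For a graph $G$, $\mathrm{bal}_r(n,G)$ is the minimum integer $m$ (if it exists) such that every $r$-edge-coloring of $K_n$ with more than $m$ edges in each of the $r$ colors contains a balanced copy of $G$ (a subgraph isomorphic to $G$ whose inherited coloring is balanced); if no such $m$ exists, $\mathrm{bal}_r(n,G)=\infty$. -}

module Defs where

open import Data.Nat using (ℕ; suc; _+_; _*_; _∸_; _^_; _≤_; _<_; NonZero)
open import Data.Nat.DivMod using (_/_)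
open import Data.Fin as F using (Fin; inject₁)
open import Data.Fin.Properties as FP using ()
open import Data.List using (List; length; filter; allFin; cartesianProduct)
open import Data.Product using (Σ; ∃-syntax; _×_; _,_)
open import Relation.Nullary.Decidable using (_×-dec_)
open import Relation.Binary.PropositionalEquality using (_≡_)
open import Function.Definitions using (Injective)

-- An r-edge-colouring of K_n on vertex set Fin n: colour of edge {i,j}
-- is c i j (required to be symmetric; diagonal values are irrelevant).
Coloring : ℕ → ℕ → Set
Coloring r n = Fin n → Fin n → Fin r

SymmetricColoring : ∀ {r n} → Coloring r n → Set
SymmetricColoring {n = n} c = (i j : Fin n) → c i j ≡ c j i

edgeCount : ∀ {r n} → Coloring r n → Fin r → ℕ
edgeCount {n = n} c a =
  length (filter (λ p → (Data.Product.proj₁ p F.<? Data.Product.proj₂ p)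
                         ×-dec (c (Data.Product.proj₁ p) (Data.Product.proj₂ p) FP.≟ a))
                 (cartesianProduct (allFin n) (allFin n)))

-- A copy of the path P_m (m edges) in K_n: m+1 distinct vertices v 0, ..., v m,
-- with edges {v i, v (i+1)}.
PathCopy : ℕ → ℕ → Set
PathCopy n m = Σ (Fin (suc m) → Fin n) (Injective _≡_ _≡_)

pathColorCount : ∀ {r n m} → Coloring r n → PathCopy n m → Fin r → ℕ
pathColorCount {m = m} c (v , _) a =
  length (filter (λ i → c (v (inject₁ i)) (v (F.suc i)) FP.≟ a) (allFin m))

-- balanced: each colour appears floor(m/r) or ceil(m/r) times, i.e. between them
Balanced : ∀ {r n m} .{{_ : NonZero r}} → Coloring r n → PathCopy n m → Set
Balanced {r} {m = m} c P =
  (a : Fin r) → (m / r ≤ pathColorCount c P a) × (pathColorCount c P a ≤ (m + (r ∸ 1)) / r)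

-- BalBound r n m b  :  every symmetric r-colouring of K_n with more than b edges
-- in each colour contains a balanced copy of P_m.
-- By definition of bal_r(n,P_m) as the minimum such b (the property is monotone in b),
-- this is exactly  bal_r(n, P_m) ≤ b.
BalBound : (r : ℕ) .{{_ : NonZero r}} → ℕ → ℕ → ℕ → Set
BalBound r n m b =
  (c : Coloring r n) → SymmetricColoring c →
  ((a : Fin r) → b < edgeCount c a) →
  Σ (PathCopy n m) (λ P → Balanced c P)

-- bal_r(n, P_m) = o(n^2) as n → ∞: for every ε = 1/(d+1) there is N such that
-- bal_r(n, P_m) ≤ ⌊n²/(d+1)⌋ for all n ≥ N.
BalLittleO : (r : ℕ) .{{_ : NonZero r}} → ℕ → Set
BalLittleO r m = (d : ℕ) → ∃[ N ] ((n : ℕ) → N ≤ n → BalBound r n m ((n ^ 2) / suc d))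

{-# OPTIONS --safe #-}

-- Kővári–Sós–Turán gives, for each colour a, a large biclique (A a , B a) all of whose edges have
-- colour a. Walk through all the bicliques once, using one edge of each; among many vertex-disjoint
-- such walks, two have the same number of edges of each colour. Reversing one of them and joining it
-- to the other through two edges of a biclique gives a path on which every colour appears an even
-- (and bounded) number of times. Replacing an edge x y of (A a , B a) by x u v y with fresh u ∈ B a
-- and v ∈ A a adds exactly two edges of colour a, so every colour can be raised to 2k.

module Submission where

open import Defs
open import Data.Nat using (ℕ; zero; suc; pred; _+_; _*_; _∸_; _^_; _≤_; _<_; _≤?_; z≤n; s≤s; NonZero; >-nonZero)
open import Data.Nat.Properties hiding (_≟_)
open import Data.Nat.DivMod using (_/_; _%_; m≡m%n+[m/n]*n; m%n<n; m*n/n≡m; /-monoˡ-≤)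
open import Data.Nat.ListAction using (sum)
open import Data.Nat.Tactic.RingSolver using (solve-∀)
open import Data.Fin as F using (Fin; toℕ; fromℕ<; funToFin; finToFun; inject₁)
open import Data.Fin.Properties using (_≟_; any?; pigeonhole; finToFun-funToFin; toℕ-fromℕ<)
import Data.Fin.Properties as FP
open import Data.List using (List; []; _∷_; [_]; _++_; _ʳ++_; length; filter; map; take; lookup; replicate; tabulate; allFin; cartesianProduct)
open import Data.List.Properties using (length-++; length-filter; filter-++; length-take; length-tabulate; map-tabulate; tabulate-lookup)
open import Data.List.Membership.Propositional using (_∈_; _∉_)
open import Data.List.Membership.Propositional.Properties using (∈-lookup; ∈-filter⁻; ∈-++⁺ˡ; ∈-++⁺ʳ; ∈-allFin)
open import Data.List.Relation.Unary.All as All using (All; []; _∷_)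
open import Data.List.Relation.Unary.All.Properties using (¬Any⇒All¬; all-filter) renaming (filter⁺ to All-filter⁺; take⁺ to All-take⁺)
open import Data.List.Relation.Unary.Any using (here; there; index)
open import Data.List.Relation.Unary.Any.Properties using (lookup-index)
open import Data.List.Relation.Unary.AllPairs using ([]; _∷_)
open import Data.List.Relation.Unary.Unique.Propositional using (Unique)
open import Data.List.Relation.Unary.Unique.Propositional.Properties using (filter⁺; take⁺; allFin⁺; ++⁺)
open import Data.List.Relation.Binary.Disjoint.Propositional using (Disjoint)
open import Data.List.Relation.Binary.Subset.Propositional using (_⊆_)
open import Data.List.Relation.Binary.Permutation.Propositional using (_↭_; ↭-trans; prep; swap; ↭-refl; ↭⇒↭ₛ)
open import Data.List.Relation.Binary.Permutation.Propositional.Properties using (++↭ʳ++; ↭-length)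
import Data.List.Relation.Binary.Permutation.Setoid.Properties as Permutationₛ
open import Data.Product using (Σ; ∃-syntax; _×_; _,_; proj₁; proj₂)
open import Data.Sum using (_⊎_; inj₁; inj₂)
open import Function using (_∘_; id)
open import Relation.Nullary using (Dec; yes; no; does; ¬_; contradiction)
open import Relation.Nullary.Decidable using (¬?; decidable-stable; _×-dec_)
open import Relation.Unary using (Decidable)
open import Data.Bool using (true; false)
open import Relation.Binary.PropositionalEquality using (_≡_; refl; sym; trans; cong; cong₂; subst; setoid; module ≡-Reasoning)

private
  variable
    X Y : Set

+-exchange : ∀ a b c → a + (b + c) ≡ b + (a + c)
+-exchange = solve-∀

-- Counting in lists

count : {P : X → Set} → Decidable P → List X → ℕ
count P? xs = length (filter P? xs)

count-∷ : {P : X → Set} (P? : Decidable P) (x : X) (xs : List X) →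
  count P? (x ∷ xs) ≡ count P? [ x ] + count P? xs
count-∷ P? x xs with does (P? x)
... | true  = refl
... | false = refl

count-++ : {P : X → Set} (P? : Decidable P) (xs ys : List X) →
  count P? (xs ++ ys) ≡ count P? xs + count P? ys
count-++ P? xs ys = trans (cong length (filter-++ P? xs ys)) (length-++ (filter P? xs))

count-map : {P : X → Set} (P? : Decidable P) (f : Y → X) (ys : List Y) →
  count P? (map f ys) ≡ count (P? ∘ f) ys
count-map P? f []       = refl
count-map P? f (y ∷ ys) with does (P? (f y))
... | true  = cong suc (count-map P? f ys)
... | false = count-map P? f ys

count-complement : {P : X → Set} (P? : Decidable P) (xs : List X) →
  count P? xs + count (¬? ∘ P?) xs ≡ length xs
count-complement P? []       = refl
count-complement P? (x ∷ xs) with does (P? x)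
... | true  = cong suc (count-complement P? xs)
... | false = trans (+-suc _ _) (cong suc (count-complement P? xs))

count-cartesianProduct : {P : X × Y → Set} (P? : Decidable P) (xs : List X) (ys : List Y) →
  count P? (cartesianProduct xs ys) ≡ sum (map (λ x → count (λ y → P? (x , y)) ys) xs)
count-cartesianProduct P? []       ys = refl
count-cartesianProduct P? (x ∷ xs) ys =
  trans (count-++ P? (map (x ,_) ys) (cartesianProduct xs ys))
        (cong₂ _+_ (count-map P? (x ,_) ys) (count-cartesianProduct P? xs ys))

double-counting : {E : X → Y → Set} (E? : ∀ x y → Dec (E x y)) (xs : List X) (ys : List Y) →
  sum (map (λ x → count (E? x) ys) xs) ≡ sum (map (λ y → count (λ x → E? x y) xs) ys)
double-counting E? []       ys = sym (zeros ys)
  where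
  zeros : (ys : List _) → sum (map (λ _ → 0) ys) ≡ 0
  zeros []       = refl
  zeros (_ ∷ ys) = zeros ys
double-counting E? (x ∷ xs) ys =
  trans (cong (count (E? x) ys +_) (double-counting E? xs ys)) (sym (new-row ys))
  where
  new-row : ∀ ys → sum (map (λ y → count (λ x′ → E? x′ y) (x ∷ xs)) ys)
                 ≡ count (E? x) ys + sum (map (λ y → count (λ x′ → E? x′ y) xs) ys)
  new-row []       = refl
  new-row (y ∷ ys) with does (E? x y) | +-exchange (count (λ x′ → E? x′ y) xs) (count (E? x) ys) (sum (map (λ y → count (λ x′ → E? x′ y) xs) ys))
  ... | true  | exchange = cong suc (trans (cong (count (λ x′ → E? x′ y) xs +_) (new-row ys)) exchange)
  ... | false | exchange = trans (cong (count (λ x′ → E? x′ y) xs +_) (new-row ys)) exchange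

-- Averaging with cut-off `θ / q`, cleared of denominators: a heavy entry contributes at most `m` to
-- the sum, any other entry at most the cut-off.
sum-≤-heavy : (f : X → ℕ) (q θ m : ℕ) → (heavy? : Decidable (λ x → θ ≤ q * f x)) →
  (∀ x → f x ≤ m) → (xs : List X) →
  q * sum (map f xs) ≤ count heavy? xs * (q * m) + length xs * θ
sum-≤-heavy f q θ m heavy? f≤m []       = ≤-reflexive (*-zeroʳ q)
sum-≤-heavy f q θ m heavy? f≤m (x ∷ xs) with sum-≤-heavy f q θ m heavy? f≤m xs | heavy? x
... | ih | yes _ = begin
  q * (f x + sum (map f xs))                    ≡⟨ *-distribˡ-+ q (f x) _ ⟩
  q * f x + q * sum (map f xs)                  ≤⟨ +-mono-≤ (*-monoʳ-≤ q (f≤m x)) (≤-trans ih (+-monoʳ-≤ (h * (q * m)) (m≤n+m (length xs * θ) θ))) ⟩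
  q * m + (h * (q * m) + (θ + length xs * θ))   ≡⟨ +-assoc (q * m) _ _ ⟨
  q * m + h * (q * m) + (θ + length xs * θ)     ∎
  where
  open ≤-Reasoning
  h = count heavy? xs
... | ih | no θ≰ = begin
  q * (f x + sum (map f xs))               ≡⟨ *-distribˡ-+ q (f x) _ ⟩
  q * f x + q * sum (map f xs)             ≤⟨ +-mono-≤ (<⇒≤ (≰⇒> θ≰)) ih ⟩
  θ + (h * (q * m) + length xs * θ)        ≡⟨ +-exchange θ (h * (q * m)) (length xs * θ) ⟩
  h * (q * m) + (θ + length xs * θ)        ∎
  where
  open ≤-Reasoning
  h = count heavy? xs

length-*-≤-sum : (f : X → ℕ) (q m : ℕ) {xs : List X} → All (λ x → m ≤ q * f x) xs →
  length xs * m ≤ q * sum (map f xs)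
length-*-≤-sum f q m []       = z≤n
length-*-≤-sum f q m (p ∷ ps) =
  ≤-trans (+-mono-≤ p (length-*-≤-sum f q m ps)) (≤-reflexive (sym (*-distribˡ-+ q (f _) _)))

count-allFin : ∀ {r} (y : Fin r) → count (λ a → y ≟ a) (allFin r) ≡ 1
count-allFin {suc r} y = trans (cong (λ as → count (y ≟_) (F.zero ∷ as)) (sym (map-tabulate id F.suc)))
                               (split y)
  where
  none : ∀ {r} (as : List (Fin r)) → count (λ a → F.zero ≟ F.suc a) as ≡ 0
  none []       = refl
  none (_ ∷ as) = none as
  shift : ∀ {r} (z : Fin r) (as : List (Fin r)) → count (λ a → F.suc z ≟ F.suc a) as ≡ count (z ≟_) as
  shift z []       = refl
  shift z (a ∷ as) with z ≟ a
  ... | yes _ = cong suc (shift z as)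
  ... | no  _ = shift z as
  split : ∀ y → count (y ≟_) (F.zero ∷ map F.suc (allFin r)) ≡ 1
  split F.zero    = cong suc (trans (count-map (F.zero ≟_) F.suc (allFin r)) (none (allFin r)))
  split (F.suc z) = trans (count-map (F.suc z ≟_) F.suc (allFin r)) (trans (shift z (allFin r)) (count-allFin z))

-- Double counting of pairs of an entry and the colour equal to it, since each entry matches exactly
-- one colour. This recovers the length of a path from its colour counts.
length-of-equal-counts : ∀ {r} q (ys : List (Fin r)) → (∀ a → count (_≟ a) ys ≡ q) → length ys ≡ r * q
length-of-equal-counts {r} q ys eq = begin
  length ys                                         ≡⟨ ones ys ⟨
  sum (map (λ y → count (y ≟_) (allFin r)) ys)      ≡⟨ double-counting _≟_ ys (allFin r) ⟩
  sum (map (λ a → count (_≟ a) ys) (allFin r))      ≡⟨ constant (allFin r) ⟩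
  length (allFin r) * q                             ≡⟨ cong (_* q) (length-tabulate {n = r} id) ⟩
  r * q                                             ∎
  where
  open ≡-Reasoning
  ones : ∀ ys → sum (map (λ y → count (y ≟_) (allFin r)) ys) ≡ length ys
  ones []       = refl
  ones (y ∷ ys) = cong₂ _+_ (count-allFin y) (ones ys)
  constant : ∀ as → sum (map (λ a → count (_≟ a) ys) as) ≡ length as * q
  constant []       = refl
  constant (a ∷ as) = cong₂ _+_ (eq a) (constant as)

-- Supplies the list of detours to make once the number needed for each colour is known.
list-with-counts : ∀ {r} (p : Fin r → ℕ) → ∃[ ps ] (∀ a → count (_≟ a) ps ≡ p a)
list-with-counts {zero}  p = [] , λ ()
list-with-counts {suc r} p with list-with-counts (p ∘ F.suc)
... | ps , eq = replicate (p F.zero) F.zero ++ map F.suc ps , counts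
  where
  zeros : ∀ m → count (_≟ F.zero) (replicate m (F.zero {r})) ≡ m
  zeros zero    = refl
  zeros (suc m) = cong suc (zeros m)
  no-suc : ∀ (as : List (Fin r)) → count (λ a → F.suc a ≟ F.zero) as ≡ 0
  no-suc []       = refl
  no-suc (_ ∷ as) = no-suc as
  no-zero : ∀ a m → count (_≟ F.suc a) (replicate m (F.zero {r})) ≡ 0
  no-zero a zero    = refl
  no-zero a (suc m) = no-zero a m
  shift : ∀ a (as : List (Fin r)) → count (λ b → F.suc b ≟ F.suc a) as ≡ count (_≟ a) as
  shift a []       = refl
  shift a (b ∷ as) with b ≟ a
  ... | yes _ = cong suc (shift a as)
  ... | no  _ = shift a as
  counts : ∀ a → count (_≟ a) (replicate (p F.zero) F.zero ++ map F.suc ps) ≡ p a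
  counts F.zero = begin
    count (_≟ F.zero) (replicate (p F.zero) F.zero ++ map F.suc ps)
      ≡⟨ count-++ (_≟ F.zero) (replicate (p F.zero) F.zero) _ ⟩
    count (_≟ F.zero) (replicate (p F.zero) F.zero) + count (_≟ F.zero) (map F.suc ps)
      ≡⟨ cong₂ _+_ (zeros (p F.zero)) (trans (count-map (_≟ F.zero) F.suc ps) (no-suc ps)) ⟩
    p F.zero + 0
      ≡⟨ +-identityʳ _ ⟩
    p F.zero ∎
    where open ≡-Reasoning
  counts (F.suc a) = begin
    count (_≟ F.suc a) (replicate (p F.zero) F.zero ++ map F.suc ps)
      ≡⟨ count-++ (_≟ F.suc a) (replicate (p F.zero) F.zero) _ ⟩
    count (_≟ F.suc a) (replicate (p F.zero) F.zero) + count (_≟ F.suc a) (map F.suc ps)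
      ≡⟨ cong₂ _+_ (no-zero a (p F.zero)) (trans (count-map (_≟ F.suc a) F.suc ps) (shift a ps)) ⟩
    count (_≟ a) ps
      ≡⟨ eq a ⟩
    p (F.suc a) ∎
    where open ≡-Reasoning

-- Lists without repetition

∉⇒Unique-∷ : {x : X} {xs : List X} → x ∉ xs → Unique xs → Unique (x ∷ xs)
∉⇒Unique-∷ x∉xs u = ¬Any⇒All¬ _ x∉xs ∷ u

lookup-injective : {xs : List X} → Unique xs → ∀ {i j} → lookup xs i ≡ lookup xs j → i ≡ j
lookup-injective (_  ∷ _) {F.zero}  {F.zero}  _  = refl
lookup-injective (x≢ ∷ _) {F.zero}  {F.suc j} eq = contradiction eq (All.lookup x≢ (∈-lookup j))
lookup-injective (x≢ ∷ _) {F.suc i} {F.zero}  eq = contradiction (sym eq) (All.lookup x≢ (∈-lookup i))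
lookup-injective (_  ∷ u) {F.suc i} {F.suc j} eq = cong F.suc (lookup-injective u eq)

Unique-resp-↭ : {xs ys : List X} → xs ↭ ys → Unique xs → Unique ys
Unique-resp-↭ {X = X} xs↭ys = Permutationₛ.Unique-resp-↭ (setoid X) (↭⇒↭ₛ xs↭ys)

-- If all of `xs` were in `used`, mapping positions to positions would send two positions of `xs` to
-- the same place, against uniqueness.
fresh : ∀ {n} {xs : List (Fin n)} (used : List (Fin n)) → Unique xs → length used < length xs →
  ∃[ x ] (x ∈ xs × x ∉ used)
fresh {xs = xs} used u lt with any? (λ i → ¬? (lookup xs i ∈? used))
  where open import Data.List.Membership.DecPropositional _≟_ using (_∈?_)
... | yes (i , x∉) = lookup xs i , ∈-lookup i , x∉
... | no  ¬∃ = contradiction i≡j (FP.<⇒≢ i<j)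
  where
  open import Data.List.Membership.DecPropositional _≟_ using (_∈?_)
  all-used : ∀ i → lookup xs i ∈ used
  all-used i = decidable-stable (lookup xs i ∈? used) (λ x∉ → ¬∃ (i , x∉))
  collision = pigeonhole lt (λ i → index (all-used i))
  i = proj₁ collision
  j = proj₁ (proj₂ collision)
  i<j = proj₁ (proj₂ (proj₂ collision))
  i≡j : i ≡ j
  i≡j = lookup-injective u (trans (lookup-index (all-used i))
          (trans (cong (lookup used) (proj₂ (proj₂ (proj₂ collision)))) (sym (lookup-index (all-used j)))))

-- Bicliques in dense relations

record Biclique (E : X → Y → Set) (xs : List X) (ys : List Y) (s t : ℕ) : Set where
  field
    left         : List X
    right        : List Y
    left⊆        : left ⊆ xs
    right⊆       : right ⊆ ys
    left-unique  : Unique left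
    right-unique : Unique right
    left-size    : s ≤ length left
    right-size   : t ≤ length right
    complete     : ∀ {x y} → x ∈ left → y ∈ right → E x y

-- Each row splits the columns into neighbours and non-neighbours; keeping the larger part costs a factor 2.
biclique-of-rich-columns : {E : X → Y → Set} (E? : ∀ x y → Dec (E x y)) (s t : ℕ) → 1 ≤ t →
  (xs : List X) (ys : List Y) → Unique xs → Unique ys →
  All (λ y → s ≤ count (λ x → E? x y) xs) ys → 2 ^ length xs * t ≤ length ys →
  Biclique E xs ys s t
-- `1 ≤ t` leaves at least one column when the rows run out; the richness of that column then forces
-- `s` to be 0.
biclique-of-rich-columns E? s t 1≤t [] []       _  _   _ t≤0 =
  contradiction (≤-trans 1≤t (≤-trans (m≤m+n t 0) t≤0)) (λ ())
biclique-of-rich-columns E? s t 1≤t [] (y ∷ ys) ux uy (s≤0 ∷ _) t≤ = record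
  { left = [] ; right = y ∷ ys ; left⊆ = id ; right⊆ = id ; left-unique = [] ; right-unique = uy
  ; left-size = s≤0 ; right-size = ≤-trans (m≤m+n t 0) t≤ ; complete = λ () }
biclique-of-rich-columns {E = E} E? s t 1≤t (x ∷ xs) ys (x≢ ∷ ux) uy rich t≤ = split (≤-total half (length on))
  where
  half = 2 ^ length xs * t
  on   = filter (E? x) ys
  off  = filter (¬? ∘ E? x) ys

  -- Neighbours of `x` already have one row, so they need only `pred s` among the remaining ones.
  on-rich : All (λ y → pred s ≤ count (λ x → E? x y) xs) on
  on-rich = All.map (λ {y} p → ≤-trans (pred-mono-≤ p) (pred-count y)) (All-filter⁺ (E? x) rich)
    where
    pred-count : ∀ y → pred (count (λ x → E? x y) (x ∷ xs)) ≤ count (λ x → E? x y) xs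
    pred-count y with does (E? x y)
    ... | true  = ≤-refl
    ... | false = pred[n]≤n

  off-rich : All (λ y → s ≤ count (λ x → E? x y) xs) off
  off-rich = All.zipWith (λ {y} (p , ¬e) → ≤-trans p (same-count y ¬e))
                         (All-filter⁺ (¬? ∘ E? x) rich , all-filter (¬? ∘ E? x) ys)
    where
    same-count : ∀ y → ¬ E x y → count (λ x → E? x y) (x ∷ xs) ≤ count (λ x → E? x y) xs
    same-count y ¬e with E? x y
    ... | yes e = contradiction e ¬e
    ... | no  _ = ≤-refl

  split : half ≤ length on ⊎ length on ≤ half → Biclique E (x ∷ xs) ys s t
  split (inj₁ half≤) = record
    { left = x ∷ left ; right = right
    ; left⊆ = λ { (here eq) → here eq ; (there x∈) → there (left⊆ x∈) }
    ; right⊆ = λ y∈ → proj₁ (∈-filter⁻ (E? x) (right⊆ y∈))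
    ; left-unique = All.tabulate (λ x∈ → All.lookup x≢ (left⊆ x∈)) ∷ left-unique
    ; right-unique = right-unique
    ; left-size = ≤-trans (suc-pred-≥ s) (s≤s left-size)
    ; right-size = right-size
    ; complete = λ { (here refl) y∈ → proj₂ (∈-filter⁻ (E? x) {xs = ys} (right⊆ y∈))
                   ; (there x∈) y∈ → complete x∈ y∈ } }
    where
    open Biclique (biclique-of-rich-columns E? (pred s) t 1≤t xs on ux (filter⁺ (E? x) uy) on-rich half≤)
    suc-pred-≥ : ∀ s → s ≤ suc (pred s)
    suc-pred-≥ zero    = z≤n
    suc-pred-≥ (suc s) = ≤-refl
  split (inj₂ ≤half) = record
    { left = left ; right = right ; left⊆ = there ∘ left⊆
    ; right⊆ = λ y∈ → proj₁ (∈-filter⁻ (¬? ∘ E? x) (right⊆ y∈))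
    ; left-unique = left-unique ; right-unique = right-unique
    ; left-size = left-size ; right-size = right-size ; complete = complete }
    where
    half≤off : half ≤ length off
    half≤off = +-cancelˡ-≤ half half (length off) (begin
      half + half              ≡⟨ double (2 ^ length xs) t ⟩
      2 ^ length (x ∷ xs) * t  ≤⟨ t≤ ⟩
      length ys                ≡⟨ count-complement (E? x) ys ⟨
      length on + length off   ≤⟨ +-monoˡ-≤ (length off) ≤half ⟩
      half + length off        ∎)
      where
      open ≤-Reasoning
      double : ∀ a b → a * b + a * b ≡ (a + (a + 0)) * b
      double = solve-∀
    open Biclique (biclique-of-rich-columns E? s t 1≤t xs off ux (filter⁺ (¬? ∘ E? x) uy) off-rich half≤off)

-- The number of heavy rows to keep. With `q = 2 * suc d`, that many rows of degree at least `n / q`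
-- give the columns average degree at least `suc t`, one more than is asked of a rich column.
row-number : ℕ → ℕ → ℕ
row-number d t = 2 * suc d * suc t

-- The first summand secures enough heavy rows, the second enough rich columns.
biclique-threshold : ℕ → ℕ → ℕ
biclique-threshold d t = 2 * suc d * row-number d t + 2 ^ row-number d t * t * row-number d t

-- Kővári-Sós-Turán by averaging twice. Keeping a number of heavy rows independent of `n` makes the
-- loss factor `2 ^ length rows` a constant.
dense⇒biclique : ∀ {n} {E : Fin n → Fin n → Set} (E? : ∀ x y → Dec (E x y)) (d t : ℕ) → 1 ≤ t →
  biclique-threshold d t ≤ n →
  n * n ≤ sum (map (λ x → count (E? x) (allFin n)) (allFin n)) * suc d →
  Biclique E (allFin n) (allFin n) t t
dense⇒biclique {n} {E} E? d t 1≤t N≤n dense = record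
  { left = left ; right = right ; left⊆ = λ _ → ∈-allFin _ ; right⊆ = λ _ → ∈-allFin _
  ; left-unique = left-unique ; right-unique = right-unique
  ; left-size = left-size ; right-size = right-size ; complete = complete }
  where
  open ≤-Reasoning
  q = 2 * suc d
  m = row-number d t

  degree : Fin n → ℕ
  degree x = count (E? x) (allFin n)

  heavy? : Decidable (λ x → n ≤ q * degree x)
  heavy? x = n ≤? q * degree x

  heavy = filter heavy? (allFin n)

  |allFin| : length (allFin n) ≡ n
  |allFin| = length-tabulate {n = n} id

  0<n : 0 < n
  0<n = ≤-trans (s≤s z≤n) (≤-trans (m≤m+n (q * m) _) N≤n)

  many-heavy : m ≤ length heavy
  -- The density is doubled so that light rows, which account for at most `n * n`, leave another
  -- `n * n` for the heavy ones.
  many-heavy = *-cancelˡ-≤ q (≤-trans (≤-trans (m≤m+n (q * m) _) N≤n)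
                 (*-cancelʳ-≤ n (q * length heavy) n {{>-nonZero 0<n}} (+-cancelʳ-≤ (n * n) _ _ (begin
    n * n + n * n                            ≤⟨ +-mono-≤ dense dense ⟩
    e * suc d + e * suc d                    ≡⟨ double e (suc d) ⟩
    q * e                                    ≤⟨ sum-≤-heavy degree q n n heavy? degree≤n (allFin n) ⟩
    length heavy * (q * n) + length (allFin n) * n
                                             ≡⟨ cong₂ _+_ (rearrange (length heavy) q n) (cong (_* n) |allFin|) ⟩
    q * length heavy * n + n * n             ∎))))
    where
    e = sum (map degree (allFin n))
    degree≤n : ∀ x → degree x ≤ n
    degree≤n x = ≤-trans (length-filter (E? x) (allFin n)) (≤-reflexive |allFin|)
    double : ∀ e d → e * d + e * d ≡ 2 * d * e
    double = solve-∀
    rearrange : ∀ h q n → h * (q * n) ≡ q * h * n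
    rearrange = solve-∀

  rows = take m heavy

  |rows| : length rows ≡ m
  |rows| = trans (length-take m heavy) (m≤n⇒m⊓n≡m many-heavy)

  codegree : Fin n → ℕ
  codegree y = count (λ x → E? x y) rows

  -- The factor `q` on both sides matches the one in the degree bound of the rows and is cancelled
  -- at the end.
  rich? : Decidable (λ y → q * t ≤ q * codegree y)
  rich? y = q * t ≤? q * codegree y

  rich = filter rich? (allFin n)

  many-rich : 2 ^ length rows * t ≤ length rich
  -- There are at least `suc t * n` incidences, of which poor columns hold at most `t * n`; at least
  -- `n` remain for rich columns, each holding at most `m`.
  many-rich rewrite |rows| =
    *-cancelʳ-≤ _ _ m (≤-trans (≤-trans (m≤n+m _ (q * m)) N≤n) (*-cancelˡ-≤ q (+-cancelʳ-≤ (n * (q * t)) _ _ (begin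
    q * n + n * (q * t)                      ≡⟨ expand q n t ⟩
    m * n                                    ≡⟨ cong (_* n) |rows| ⟨
    length rows * n                          ≤⟨ length-*-≤-sum degree q n (All-take⁺ m (all-filter heavy? (allFin n))) ⟩
    q * sum (map degree rows)                ≡⟨ cong (q *_) (double-counting E? rows (allFin n)) ⟩
    q * sum (map codegree (allFin n))        ≤⟨ sum-≤-heavy codegree q (q * t) m rich? codegree≤m (allFin n) ⟩
    length rich * (q * m) + length (allFin n) * (q * t)
                                             ≡⟨ cong₂ _+_ (rearrange (length rich) q m) (cong (_* (q * t)) |allFin|) ⟩
    q * (length rich * m) + n * (q * t)      ∎))))
    where
    codegree≤m : ∀ y → codegree y ≤ m
    codegree≤m y = ≤-trans (length-filter (λ x → E? x y) rows) (≤-reflexive |rows|)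
    expand : ∀ q n t → q * n + n * (q * t) ≡ q * suc t * n
    expand = solve-∀
    rearrange : ∀ h q m → h * (q * m) ≡ q * (h * m)
    rearrange = solve-∀

  open Biclique (biclique-of-rich-columns E? t t 1≤t rows rich
    (take⁺ m (filter⁺ heavy? (allFin⁺ n))) (filter⁺ rich? (allFin⁺ n))
    (All.map (*-cancelˡ-≤ q) (all-filter rich? (allFin n))) many-rich)

-- Coloured paths as lists of vertices

module ColouredPaths {r n : ℕ} (c : Coloring r n) where

  colours : List (Fin n) → List (Fin r)
  colours []           = []
  colours (_ ∷ [])     = []
  colours (x ∷ y ∷ xs) = c x y ∷ colours (y ∷ xs)

  uses : Fin r → List (Fin n) → ℕ
  uses a xs = count (_≟ a) (colours xs)

  uses-∷ : ∀ a x y xs → uses a (x ∷ y ∷ xs) ≡ count (_≟ a) [ c x y ] + uses a (y ∷ xs)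
  uses-∷ a x y xs = count-∷ (_≟ a) (c x y) (colours (y ∷ xs))

  uses-∷-shift : ∀ a x y {xs ys s} → uses a (y ∷ ys) ≡ uses a (y ∷ xs) + s →
    uses a (x ∷ y ∷ ys) ≡ uses a (x ∷ y ∷ xs) + s
  uses-∷-shift a x y {xs} {ys} {s} eq = begin
    uses a (x ∷ y ∷ ys)                             ≡⟨ uses-∷ a x y ys ⟩
    count (_≟ a) [ c x y ] + uses a (y ∷ ys)        ≡⟨ cong (count (_≟ a) [ c x y ] +_) eq ⟩
    count (_≟ a) [ c x y ] + (uses a (y ∷ xs) + s)  ≡⟨ +-assoc (count (_≟ a) [ c x y ]) _ s ⟨
    count (_≟ a) [ c x y ] + uses a (y ∷ xs) + s    ≡⟨ cong (_+ s) (uses-∷ a x y xs) ⟨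
    uses a (x ∷ y ∷ xs) + s                         ∎
    where open ≡-Reasoning

  length-colours : ∀ x xs → length (colours (x ∷ xs)) ≡ length xs
  length-colours x []       = refl
  length-colours x (y ∷ xs) = cong suc (length-colours y xs)

  uses≤length : ∀ a xs → uses a xs ≤ length xs
  uses≤length a []       = z≤n
  uses≤length a (x ∷ xs) = begin
    uses a (x ∷ xs)             ≤⟨ length-filter (_≟ a) (colours (x ∷ xs)) ⟩
    length (colours (x ∷ xs))   ≡⟨ length-colours x xs ⟩
    length xs                   ≤⟨ n≤1+n (length xs) ⟩
    length (x ∷ xs)             ∎
    where open ≤-Reasoning

  -- `ʳ++` reverses the first list onto the second, so the two heads become adjacent. Symmetry keeps
  -- the colour of every reversed edge.
  uses-ʳ++ : SymmetricColoring c → ∀ a x xs y ys →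
    uses a ((x ∷ xs) ʳ++ (y ∷ ys)) ≡ uses a (x ∷ xs) + (count (_≟ a) [ c x y ] + uses a (y ∷ ys))
  uses-ʳ++ symm a x []        y ys = uses-∷ a x y ys
  uses-ʳ++ symm a x (x′ ∷ xs) y ys = begin
    uses a ((x′ ∷ xs) ʳ++ (x ∷ y ∷ ys))
      ≡⟨ uses-ʳ++ symm a x′ xs x (y ∷ ys) ⟩
    uses a (x′ ∷ xs) + (count (_≟ a) [ c x′ x ] + uses a (x ∷ y ∷ ys))
      ≡⟨ cong₂ (λ b u → uses a (x′ ∷ xs) + (count (_≟ a) [ b ] + u)) (symm x′ x) (uses-∷ a x y ys) ⟩
    uses a (x′ ∷ xs) + (count (_≟ a) [ c x x′ ] + rest)
      ≡⟨ +-exchange (uses a (x′ ∷ xs)) (count (_≟ a) [ c x x′ ]) rest ⟩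
    count (_≟ a) [ c x x′ ] + (uses a (x′ ∷ xs) + rest)
      ≡⟨ +-assoc (count (_≟ a) [ c x x′ ]) (uses a (x′ ∷ xs)) rest ⟨
    count (_≟ a) [ c x x′ ] + uses a (x′ ∷ xs) + rest
      ≡⟨ cong (_+ rest) (uses-∷ a x x′ xs) ⟨
    uses a (x ∷ x′ ∷ xs) + rest ∎
    where
    open ≡-Reasoning
    rest = count (_≟ a) [ c x y ] + uses a (y ∷ ys)

  uses-tabulate : ∀ a m (v : Fin (suc m) → Fin n) →
    count (λ i → c (v (inject₁ i)) (v (F.suc i)) ≟ a) (allFin m) ≡ uses a (tabulate v)
  uses-tabulate a zero    v = refl
  uses-tabulate a (suc m) v = begin
    count P? (F.zero ∷ tabulate F.suc)
      ≡⟨ count-∷ P? F.zero (tabulate F.suc) ⟩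
    count P? [ F.zero ] + count P? (tabulate F.suc)
      ≡⟨ cong₂ _+_ (sym (count-map (_≟ a) (λ i → c (v (inject₁ i)) (v (F.suc i))) [ F.zero ]))
                   (trans (cong (count P?) (sym (map-tabulate id F.suc))) (count-map P? F.suc (allFin m))) ⟩
    count (_≟ a) [ c (v F.zero) (v (F.suc F.zero)) ] + count (P? ∘ F.suc) (allFin m)
      ≡⟨ cong (count (_≟ a) [ c (v F.zero) (v (F.suc F.zero)) ] +_) (uses-tabulate a m (v ∘ F.suc)) ⟩
    count (_≟ a) [ c (v F.zero) (v (F.suc F.zero)) ] + uses a (tabulate (v ∘ F.suc))
      ≡⟨ uses-∷ a (v F.zero) (v (F.suc F.zero)) _ ⟨
    uses a (tabulate v) ∎
    where
    open ≡-Reasoning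
    P? : Decidable (λ i → c (v (inject₁ i)) (v (F.suc i)) ≡ a)
    P? i = c (v (inject₁ i)) (v (F.suc i)) ≟ a

  list⇒PathCopy : ∀ {m} xs → Unique xs → length xs ≡ suc m →
    Σ (PathCopy n m) (λ p → ∀ a → pathColorCount c p a ≡ uses a xs)
  list⇒PathCopy (x ∷ xs) u refl =
    (lookup (x ∷ xs) , lookup-injective u) ,
    λ a → trans (uses-tabulate a (length xs) (lookup (x ∷ xs))) (cong (uses a) (tabulate-lookup (x ∷ xs)))

-- For each colour a, (A a , B a) is a biclique of colour a; distinct bicliques may overlap.
module Balancing {r n : ℕ} (c : Coloring (suc r) n) (symm : SymmetricColoring c)
  (T : ℕ) (A B : Fin (suc r) → List (Fin n))
  (A-unique : ∀ a → Unique (A a)) (B-unique : ∀ a → Unique (B a))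
  (A-size : ∀ a → T ≤ length (A a)) (B-size : ∀ a → T ≤ length (B a))
  (A-B : ∀ a {x y} → x ∈ A a → y ∈ B a → c x y ≡ a)
  where

  open ColouredPaths c

  -- Fresh vertices and detours inside a biclique

  freshA : ∀ a used → length used < T → ∃[ x ] (x ∈ A a × x ∉ used)
  freshA a used lt = fresh used (A-unique a) (≤-trans lt (A-size a))

  freshB : ∀ a used → length used < T → ∃[ y ] (y ∈ B a × y ∉ used)
  freshB a used lt = fresh used (B-unique a) (≤-trans lt (B-size a))

  -- A witness records a position and so tells `detour` where to act. The orientation from `A a` to
  -- `B a` along the list is fixed.
  data Crosses (a : Fin (suc r)) : List (Fin n) → Set where
    here  : ∀ {x y xs} → x ∈ A a → y ∈ B a → Crosses a (x ∷ y ∷ xs)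
    there : ∀ {x xs} → Crosses a xs → Crosses a (x ∷ xs)

  detour : ∀ {a xs} → Crosses a xs → Fin n → Fin n → List (Fin n)
  detour (here {x} {y} {xs} _ _) u v = x ∷ u ∷ v ∷ y ∷ xs
  detour (there {x} cr)          u v = x ∷ detour cr u v

  -- Since a detour only rearranges `u ∷ v ∷ xs`, this yields both the distinctness and the length
  -- of the new path.
  detour-↭ : ∀ {a xs} (cr : Crosses a xs) u v → u ∷ v ∷ xs ↭ detour cr u v
  detour-↭ (here {x} _ _)  u v = ↭-trans (prep u (swap v x ↭-refl)) (swap u x ↭-refl)
  detour-↭ (there {x} cr)  u v =
    ↭-trans (prep u (swap v x ↭-refl)) (↭-trans (swap u x ↭-refl) (prep x (detour-↭ cr u v)))

  -- Only the subdivided edge `x y` disappears. An edge has one colour, so a crossing of `b` there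
  -- forces `b` to be `a`, and `x u` replaces it.
  detour-Crosses : ∀ {a b xs} (cr : Crosses a xs) {u v} → u ∈ B a →
    Crosses b xs → Crosses b (detour cr u v)
  detour-Crosses (here x∈A y∈B)     u∈B (here x∈A′ y∈B′)
    with refl ← trans (sym (A-B _ x∈A y∈B)) (A-B _ x∈A′ y∈B′) = here x∈A u∈B
  detour-Crosses (here x∈A y∈B)     u∈B (there cr′)      = there (there (there cr′))
  -- Splitting on the position of the detour exposes the second vertex, which the detour leaves in
  -- place.
  detour-Crosses (there (here _ _)) u∈B (here x∈A′ y∈B′) = here x∈A′ y∈B′
  detour-Crosses (there (there _))  u∈B (here x∈A′ y∈B′) = here x∈A′ y∈B′
  detour-Crosses (there cr)         u∈B (there cr′)      = there (detour-Crosses cr u∈B cr′)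

  uses-detour : ∀ {a xs} (cr : Crosses a xs) {u v} → u ∈ B a → v ∈ A a → ∀ b →
    uses b (detour cr u v) ≡ uses b xs + 2 * count (_≟ b) [ a ]
  uses-detour {a} (here {x} {y} {xs} x∈A y∈B) {u} {v} u∈B v∈A b = begin
    uses b (x ∷ u ∷ v ∷ y ∷ xs)
      ≡⟨ uses-∷ b x u (v ∷ y ∷ xs) ⟩
    # (c x u) + uses b (u ∷ v ∷ y ∷ xs)
      ≡⟨ cong (# (c x u) +_) (trans (uses-∷ b u v (y ∷ xs)) (cong (# (c u v) +_) (uses-∷ b v y xs))) ⟩
    # (c x u) + (# (c u v) + (# (c v y) + uses b (y ∷ xs)))
      ≡⟨ cong₂ (λ e f → # e + (# f + (# (c v y) + uses b (y ∷ xs))))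
               (A-B a x∈A u∈B) (trans (symm u v) (A-B a v∈A u∈B)) ⟩
    # a + (# a + (# (c v y) + uses b (y ∷ xs)))
      -- `v y` has the colour of the removed edge `x y` and stands in for it, so the gain is exactly
      -- two.
      ≡⟨ cong (λ e → # a + (# a + (# e + uses b (y ∷ xs)))) (trans (A-B a v∈A y∈B) (sym (A-B a x∈A y∈B))) ⟩
    # a + (# a + (# (c x y) + uses b (y ∷ xs)))
      ≡⟨ rearrange (# a) (# (c x y) + uses b (y ∷ xs)) ⟩
    # (c x y) + uses b (y ∷ xs) + 2 * # a
      ≡⟨ cong (_+ 2 * # a) (uses-∷ b x y xs) ⟨
    uses b (x ∷ y ∷ xs) + 2 * # a ∎
    where
    open ≡-Reasoning
    # : Fin (suc r) → ℕ
    # e = count (_≟ b) [ e ]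
    rearrange : ∀ i j → i + (i + j) ≡ j + 2 * i
    rearrange = solve-∀
  uses-detour (there {x} cr@(here {y} _ _)) u∈B v∈A b = uses-∷-shift b x y (uses-detour cr u∈B v∈A b)
  uses-detour (there {x} cr@(there {y} _))  u∈B v∈A b = uses-∷-shift b x y (uses-detour cr u∈B v∈A b)

  -- One detour per entry of `as`; each leaves a crossing of every colour for the next. Bounding the
  -- final length by `T` suffices, as every intermediate path is shorter.
  pad : ∀ as xs → Unique xs → (∀ b → Crosses b xs) → length xs + 2 * length as ≤ T →
    ∃[ ys ] (Unique ys × length ys ≡ length xs + 2 * length as ×
             (∀ b → uses b ys ≡ uses b xs + 2 * count (_≟ b) as))
  pad []       xs unique cross _ =
    xs , unique , sym (+-identityʳ _) , λ b → sym (+-identityʳ _)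
  pad (a ∷ as) xs unique cross fits =
    let u , u∈B , u∉ = freshB a xs (<⇒≤ 2+|xs|≤T)
        v , v∈A , v∉ = freshA a (u ∷ xs) 2+|xs|≤T
        xs′          = detour (cross a) u v
        uv-unique    = ∉⇒Unique-∷ (λ { (here u≡v) → v∉ (here (sym u≡v)) ; (there u∈) → u∉ u∈ })
                                  (∉⇒Unique-∷ (v∉ ∘ there) unique)
        |xs′|        = sym (↭-length (detour-↭ (cross a) u v))
        ys , ys-unique , |ys| , uses-ys =
          pad as xs′ (Unique-resp-↭ (detour-↭ (cross a) u v) uv-unique)
              (λ b → detour-Crosses (cross a) u∈B (cross b))
              (≤-trans (≤-reflexive (trans (cong (_+ 2 * length as) |xs′|) (shift (length xs) (length as)))) fits)
    in ys , ys-unique ,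
       trans |ys| (trans (cong (_+ 2 * length as) |xs′|) (shift (length xs) (length as))) ,
       λ b → begin
         uses b ys
           ≡⟨ uses-ys b ⟩
         uses b xs′ + 2 * count (_≟ b) as
           ≡⟨ cong (_+ 2 * count (_≟ b) as) (uses-detour (cross a) u∈B v∈A b) ⟩
         uses b xs + 2 * count (_≟ b) [ a ] + 2 * count (_≟ b) as
           ≡⟨ collect (uses b xs) (count (_≟ b) [ a ]) (count (_≟ b) as) ⟩
         uses b xs + 2 * (count (_≟ b) [ a ] + count (_≟ b) as)
           ≡⟨ cong (λ m → uses b xs + 2 * m) (count-∷ (_≟ b) a as) ⟨
         uses b xs + 2 * count (_≟ b) (a ∷ as) ∎
    where
    open ≡-Reasoning
    shift : ∀ i j → suc (suc i) + 2 * j ≡ i + 2 * suc j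
    shift = solve-∀
    collect : ∀ i j k → i + 2 * j + 2 * k ≡ i + 2 * (j + k)
    collect = solve-∀
    2+|xs|≤T : suc (suc (length xs)) ≤ T
    2+|xs|≤T = ≤-trans (≤-trans (m≤m+n _ (2 * length as)) (≤-reflexive (shift (length xs) (length as)))) fits

  -- Chains through the bicliques

  -- The edges between consecutive linked pairs may have any colour.
  data Chain : List (Fin (suc r)) → List (Fin n) → Set where
    []   : Chain [] []
    link : ∀ {a as x y xs} → x ∈ A a → y ∈ B a → Chain as xs → Chain (a ∷ as) (x ∷ y ∷ xs)

  Chain-length : ∀ {as xs} → Chain as xs → length xs ≡ 2 * length as
  Chain-length []                       = refl
  Chain-length {a ∷ as} (link _ _ ch)   =
    trans (cong (suc ∘ suc) (Chain-length ch)) (cong suc (sym (+-suc (length as) (length as + 0))))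

  Chain-Crosses : ∀ {as xs a} → Chain as xs → a ∈ as → Crosses a xs
  Chain-Crosses (link x∈ y∈ ch) (here refl) = here x∈ y∈
  Chain-Crosses (link x∈ y∈ ch) (there a∈)  = there (there (Chain-Crosses ch a∈))

  -- Greedy choice from the end of the list. The bicliques may overlap, so each new vertex avoids
  -- the chain built so far as well as `used`.
  chain : ∀ as used → 2 * length as + length used ≤ T →
    ∃[ xs ] (Chain as xs × Unique xs × Disjoint xs used)
  chain []       used _    = [] , [] , [] , λ ()
  chain (a ∷ as) used fits =
    let xs , ch , xs-unique , xs-disjoint = chain as used (<⇒≤ (<⇒≤ fits′))
        |xs++used| = trans (length-++ xs) (cong (_+ length used) (Chain-length ch))
        y , y∈B , y∉ = freshB a (xs ++ used) (≤-trans (s≤s (≤-reflexive |xs++used|)) (<⇒≤ fits′))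
        x , x∈A , x∉ = freshA a (y ∷ xs ++ used) (≤-trans (s≤s (s≤s (≤-reflexive |xs++used|))) fits′)
    in x ∷ y ∷ xs , link x∈A y∈B ch ,
       ∉⇒Unique-∷ (λ { (here x≡y) → x∉ (here x≡y) ; (there x∈) → x∉ (there (∈-++⁺ˡ x∈)) })
         (∉⇒Unique-∷ (y∉ ∘ ∈-++⁺ˡ) xs-unique) ,
       λ { (here refl , z∈) → x∉ (there (∈-++⁺ʳ xs z∈))
         ; (there (here refl) , z∈) → y∉ (∈-++⁺ʳ xs z∈)
         ; (there (there z∈xs) , z∈) → xs-disjoint (z∈xs , z∈) }
    where
    shift : ∀ i j → 2 * suc i + j ≡ suc (suc (2 * i + j))
    shift = solve-∀
    fits′ : suc (suc (2 * length as + length used)) ≤ T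
    fits′ = ≤-trans (≤-reflexive (sym (shift (length as) (length used)))) fits

  disjoint-chains : ∀ as m → m * (2 * length as) ≤ T →
    Σ (Fin m → List (Fin n)) λ f → (∀ i → Chain as (f i)) × (∀ i → Unique (f i)) ×
      (∀ {i j} → i F.< j → Disjoint (f i) (f j))
  disjoint-chains as m fits = let f , _ , _ , _ , props = go m fits in f , props
    where
    q = 2 * length as
    -- The induction carries along the list of all vertices in earlier chains, which the next chain
    -- has to avoid.
    go : ∀ m → m * q ≤ T → Σ (Fin m → List (Fin n)) λ f → Σ (List (Fin n)) λ used →
      length used ≡ m * q × (∀ i → f i ⊆ used) × (∀ i → Chain as (f i)) × (∀ i → Unique (f i)) ×
      (∀ {i j} → i F.< j → Disjoint (f i) (f j))
    go zero    _    = (λ ()) , [] , refl , (λ ()) , (λ ()) , (λ ()) , λ { {()} }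
    go (suc m) fits =
      let f , used , |used| , f⊆ , f-chain , f-unique , f-disjoint = go m (≤-trans (m≤n+m (m * q) q) fits)
          xs , ch , xs-unique , xs-disjoint = chain as used (≤-trans (≤-reflexive (cong (q +_) |used|)) fits)
      in (λ { F.zero → xs ; (F.suc i) → f i }) , xs ++ used ,
         trans (length-++ xs) (cong₂ _+_ (Chain-length ch) |used|) ,
         (λ { F.zero → ∈-++⁺ˡ ; (F.suc i) → ∈-++⁺ʳ xs ∘ f⊆ i }) ,
         (λ { F.zero → ch ; (F.suc i) → f-chain i }) ,
         (λ { F.zero → xs-unique ; (F.suc i) → f-unique i }) ,
         λ { {F.zero} {F.suc j} _ (z∈xs , z∈) → xs-disjoint (z∈xs , f⊆ j z∈)
           ; {F.suc i} {F.suc j} (s≤s i<j) → f-disjoint i<j }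

  -- Two chains with equal colour counts

  all-colours = allFin (suc r)
  chain-length = 2 * length all-colours
  -- One more than the number of functions from the `suc r` colours to `Fin (suc chain-length)`, the
  -- possible colour profiles of a chain.
  chain-number = suc (suc chain-length ^ suc r)

  -- Pigeonhole on colour profiles, each coded as a single number by `funToFin`. A count is at most
  -- the number of vertices of the chain, so the number of chains needed does not depend on `n`.
  twin-chains : chain-number * chain-length ≤ T → ∃[ xs ] ∃[ ys ]
    (Chain all-colours xs × Chain all-colours ys × Unique xs × Unique ys × Disjoint xs ys ×
     (∀ a → uses a xs ≡ uses a ys))
  twin-chains fits =
    let f , f-chain , f-unique , f-disjoint = disjoint-chains all-colours chain-number fits
        bound : ∀ i a → uses a (f i) < suc chain-length
        bound = λ i a → s≤s (≤-trans (uses≤length a (f i)) (≤-reflexive (Chain-length (f-chain i))))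
        profile : Fin chain-number → Fin (suc r) → Fin (suc chain-length)
        profile = λ i a → fromℕ< (bound i a)
        i , j , i<j , eq = pigeonhole ≤-refl (funToFin ∘ profile)
    in f i , f j , f-chain i , f-chain j , f-unique i , f-unique j , f-disjoint i<j ,
       λ a → begin
         uses a (f i)                              ≡⟨ toℕ-fromℕ< (bound i a) ⟨
         toℕ (profile i a)                         ≡⟨ cong toℕ (finToFun-funToFin (profile i) a) ⟨
         toℕ (finToFun (funToFin (profile i)) a)   ≡⟨ cong (λ z → toℕ (finToFun z a)) eq ⟩
         toℕ (finToFun (funToFin (profile j)) a)   ≡⟨ cong toℕ (finToFun-funToFin (profile j) a) ⟩
         toℕ (profile j a)                         ≡⟨ toℕ-fromℕ< (bound j a) ⟩
         uses a (f j)                              ∎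
    where open ≡-Reasoning

  -- Gluing two chains and padding the result

  ʳ++-Crosses : ∀ {a} xs {ys} → Crosses a ys → Crosses a (xs ʳ++ ys)
  ʳ++-Crosses []       cr = cr
  ʳ++-Crosses (x ∷ xs) cr = ʳ++-Crosses xs (there cr)

  -- The equal counts of the two chains add up to even numbers, and the two edges at the joining
  -- vertex `z` have the same colour.
  even-path : chain-number * chain-length ≤ T → chain-length + chain-length < T →
    ∃[ zs ] (Unique zs × (∀ a → Crosses a zs) ×
             (∀ a → ∃[ e ] (uses a zs ≡ 2 * e × e ≤ suc chain-length)))
  even-path fits fits′ with twin-chains fits
  -- `all-colours` starts with `F.zero`, so both heads lie in `A F.zero` and one vertex of
  -- `B F.zero` joins them.
  ... | xs@(x ∷ xs₁) , ys@(y ∷ ys₁) , ch@(link x∈A _ _) , ch′@(link y∈A _ _) , ux , uy , disj , twin =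
    let z , z∈B , z∉ = freshB F.zero (xs ++ ys) (≤-trans (s≤s (≤-reflexive
                         (trans (length-++ xs) (cong₂ _+_ (Chain-length ch) (Chain-length ch′))))) fits′)
    in xs ʳ++ (z ∷ ys) ,
       Unique-resp-↭ (++↭ʳ++ xs (z ∷ ys))
         (++⁺ ux (∉⇒Unique-∷ (z∉ ∘ ∈-++⁺ʳ xs) uy)
           (λ { (z∈xs , here refl) → z∉ (∈-++⁺ˡ z∈xs) ; (v∈xs , there v∈ys) → disj (v∈xs , v∈ys) })) ,
       -- Reversal turns the crossings of `xs` the wrong way round, so the crossings are taken from
       -- `ys`.
       (λ a → ʳ++-Crosses xs (there (Chain-Crosses ch′ (∈-allFin a)))) ,
       λ a → let # = λ b → count (_≟ a) [ b ] in
         # F.zero + uses a ys ,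
         (begin
           uses a (xs ʳ++ (z ∷ ys))
             ≡⟨ uses-ʳ++ symm a x xs₁ z ys ⟩
           uses a xs + (# (c x z) + uses a (z ∷ ys))
             ≡⟨ cong₂ (λ i j → i + (# (c x z) + j)) (twin a) (uses-∷ a z y ys₁) ⟩
           uses a ys + (# (c x z) + (# (c z y) + uses a ys))
             ≡⟨ cong₂ (λ b b′ → uses a ys + (# b + (# b′ + uses a ys)))
                      (A-B F.zero x∈A z∈B) (trans (symm z y) (A-B F.zero y∈A z∈B)) ⟩
           uses a ys + (# F.zero + (# F.zero + uses a ys))
             ≡⟨ collect (uses a ys) (# F.zero) ⟩
           2 * (# F.zero + uses a ys) ∎) ,
         +-mono-≤ (length-filter (_≟ a) [ F.zero ])
                  (≤-trans (uses≤length a ys) (≤-reflexive (Chain-length ch′)))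
    where
    open ≡-Reasoning
    collect : ∀ i j → i + (j + (j + i)) ≡ 2 * (j + i)
    collect = solve-∀

  -- Colour `a` gets `k ∸ e a` detours, each adding two edges. The lower bound on `k` makes the
  -- subtraction exact.
  balanced-path : ∀ k → suc chain-length ≤ k → chain-number * chain-length ≤ T →
    chain-length + chain-length < T → suc (suc r * (2 * k)) ≤ T →
    Σ (PathCopy n (suc r * (2 * k))) (λ p → ∀ a → pathColorCount c p a ≡ 2 * k)
  balanced-path k k≥ fits fits′ fits″ with even-path fits fits′
  ... | zs , zs-unique , zs-cross , zs-even =
    let e = λ a → proj₁ (zs-even a)
        e≤k = λ a → ≤-trans (proj₂ (proj₂ (zs-even a))) k≥
        ps , ps-counts = list-with-counts (λ a → k ∸ e a)
        total : ∀ a → uses a zs + 2 * count (_≟ a) ps ≡ 2 * k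
        total = λ a → begin
          uses a zs + 2 * count (_≟ a) ps  ≡⟨ cong₂ (λ i j → i + 2 * j) (proj₁ (proj₂ (zs-even a))) (ps-counts a) ⟩
          2 * e a + 2 * (k ∸ e a)          ≡⟨ *-distribˡ-+ 2 (e a) (k ∸ e a) ⟨
          2 * (e a + (k ∸ e a))            ≡⟨ cong (2 *_) (m+[n∸m]≡n (e≤k a)) ⟩
          2 * k                            ∎
        -- `ps ++ ps` stands for the two edges that each detour adds, so the final length is read
        -- off from the colour counts.
        |zs|+2|ps| : length zs + 2 * length ps ≡ suc (suc r * (2 * k))
        |zs|+2|ps| = begin
          length zs + 2 * length ps
            ≡⟨ cong (_+ 2 * length ps) (length-nonempty (zs-cross F.zero)) ⟩
          suc (length (colours zs) + 2 * length ps)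
            ≡⟨ cong suc (length-twice (colours zs) ps) ⟨
          suc (length (colours zs ++ ps ++ ps))
            ≡⟨ cong suc (length-of-equal-counts (2 * k) (colours zs ++ ps ++ ps)
                 (λ a → trans (count-twice a (colours zs) ps) (total a))) ⟩
          suc (suc r * (2 * k)) ∎
        ys , ys-unique , |ys| , uses-ys =
          pad ps zs zs-unique zs-cross (≤-trans (≤-reflexive |zs|+2|ps|) fits″)
        p , p-counts = list⇒PathCopy ys ys-unique (trans |ys| |zs|+2|ps|)
    in p , λ a → trans (p-counts a) (trans (uses-ys a) (total a))
    where
    open ≡-Reasoning
    length-nonempty : ∀ {a xs} → Crosses a xs → length xs ≡ suc (length (colours xs))
    length-nonempty {xs = x ∷ xs} _ = cong suc (sym (length-colours x xs))
    length-twice : (xs ys : List (Fin (suc r))) → length (xs ++ ys ++ ys) ≡ length xs + 2 * length ys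
    length-twice xs ys = trans (length-++ xs) (cong (length xs +_)
      (trans (length-++ ys) (cong (length ys +_) (sym (+-identityʳ (length ys))))))
    count-twice : ∀ a (xs ys : List (Fin (suc r))) →
      count (_≟ a) (xs ++ ys ++ ys) ≡ count (_≟ a) xs + 2 * count (_≟ a) ys
    count-twice a xs ys = trans (count-++ (_≟ a) xs (ys ++ ys)) (cong (count (_≟ a) xs +_)
      (trans (count-++ (_≟ a) ys ys) (cong (count (_≟ a) ys +_) (sym (+-identityʳ (count (_≟ a) ys))))))

-- Choice of constants

theorem1p9 : (r : ℕ) .{{_ : NonZero r}} → 2 ≤ r →
    ∃[ k₀ ] ((k : ℕ) → k₀ ≤ k → BalLittleO r (2 * r * k))
-- `suc q` bounds half of every colour count before padding. The biclique size `T k` does not depend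
-- on `n`.
theorem1p9 (suc r) _ = suc q , λ k q<k d → biclique-threshold d (T k) , λ n N≤n c symm many →
  let clique = λ a → dense⇒biclique
                 -- Ordered pairs with `x` below `y`, so that the number of incidences is exactly
                 -- `edgeCount c a`.
                 (λ x y → (x F.<? y) ×-dec (c x y ≟ a)) d (T k) (s≤s z≤n) N≤n
                 (dense d n (edgeCount c a) (many a) (count-cartesianProduct
                   (λ p → (proj₁ p F.<? proj₂ p) ×-dec (c (proj₁ p) (proj₂ p) ≟ a)) (allFin n) (allFin n)))
      open Balancing c symm (T k) (λ a → left (clique a)) (λ a → right (clique a))
             (λ a → left-unique (clique a)) (λ a → right-unique (clique a))
             (λ a → left-size (clique a)) (λ a → right-size (clique a))
             (λ a x∈ y∈ → proj₂ (complete (clique a) x∈ y∈))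
  in balanced c (balanced-path k q<k (T≥₁ k) (T≥₂ k) (T≥₃ k))
  where
  open Biclique
  -- `q` and `m` repeat `chain-length` and `chain-number`, as `T` has to be fixed before `Balancing`
  -- is opened.
  q = 2 * length (allFin (suc r))
  m = suc (suc q ^ suc r)
  T : ℕ → ℕ
  -- A sum in place of the maximum of the three sizes required; the `suc` serves the last two.
  T k = suc (m * q + (q + q) + suc r * (2 * k))
  T≥₁ : ∀ k → m * q ≤ T k
  T≥₁ k = ≤-trans (m≤m+n _ (q + q)) (≤-trans (m≤m+n _ (suc r * (2 * k))) (n≤1+n _))
  T≥₂ : ∀ k → q + q < T k
  T≥₂ k = s≤s (≤-trans (m≤n+m _ (m * q)) (m≤m+n _ (suc r * (2 * k))))
  T≥₃ : ∀ k → suc (suc r * (2 * k)) ≤ T k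
  T≥₃ k = s≤s (m≤n+m _ (m * q + (q + q)))

  -- The remainder of `n ^ 2` is below `suc d`, so one edge beyond the rounded quotient makes up for
  -- it.
  dense : ∀ d n e {s} → n ^ 2 / suc d < e → e ≡ s → n * n ≤ s * suc d
  dense d n e lt refl = begin
    n * n                                        ≡⟨ cong (n *_) (*-identityʳ n) ⟨
    n ^ 2                                        ≡⟨ m≡m%n+[m/n]*n (n ^ 2) (suc d) ⟩
    n ^ 2 % suc d + n ^ 2 / suc d * suc d        ≤⟨ +-monoˡ-≤ _ (<⇒≤ (m%n<n (n ^ 2) (suc d))) ⟩
    suc (n ^ 2 / suc d) * suc d                  ≤⟨ *-monoˡ-≤ (suc d) lt ⟩
    e * suc d                                    ∎
    where open ≤-Reasoning

  -- `suc r` divides `2 * suc r * k`, so the lower bound is met with equality at `2 * k`; the upper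
  -- bound follows by monotonicity of division.
  balanced : ∀ {k n} (c : Coloring (suc r) n) →
    Σ (PathCopy n (suc r * (2 * k))) (λ p → ∀ a → pathColorCount c p a ≡ 2 * k) →
    Σ (PathCopy n (2 * suc r * k)) (λ p → Balanced c p)
  balanced {k} {n} c = subst (λ l → Σ (PathCopy n l) (λ p → ∀ a → pathColorCount c p a ≡ 2 * k) →
                                      Σ (PathCopy n (2 * suc r * k)) (λ p → Balanced c p))
    (rearrange r k) λ (p , counts) → p , λ a →
      ≤-reflexive (trans average (sym (counts a))) ,
      ≤-trans (≤-reflexive (trans (counts a) (sym average))) (/-monoˡ-≤ (suc r) (m≤m+n (2 * suc r * k) r))
    where
    rearrange : ∀ r k → 2 * suc r * k ≡ suc r * (2 * k)
    rearrange = solve-∀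
    average : 2 * suc r * k / suc r ≡ 2 * k
    average = trans (cong (_/ suc r) (trans (rearrange r k) (*-comm (suc r) (2 * k)))) (m*n/n≡m (2 * k) (suc r))
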